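{- For every positive integer $n$, $$\mathrm{opt}(n,2)\le \mathrm{constr}(n,2)\le \tfrac32\,\mathrm{opt}(n,2),$$ and if $n$ is even, then moreover $\mathrm{constr}(n,2)\le\sqrt2\,\mathrm{opt}(n,2)$.
   Context: $[n]=\{1,\dots,n\}$. An $(n,2)$-generator is a family $\mathcal G$ of subsets of $[n]$ such that every non-empty subset of $[n]$ is a disjoint union of at most $2$ members of $\mathcal G$. $\mathrm{opt}(n,2)$ is the minimum of $|\mathcal G|$ over all $(n,2)$-generators. $\mathrm{constr}(n,2):=(2^{\lfloor n/2\rfloor}-1)+(2^{\lceil n/2\rceil}-1)$ is the number of non-empty sets contained in one of the two classes of a partition of $[n]$ into two sets of sizes $\lfloor n/2\rfloor$ and $\lceil n/2\rceil$. -}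

module Defs where

open import Data.Bool using (true; false)
open import Data.Bool.Properties using () renaming (_≟_ to _≟ᵇ_)
open import Data.Empty using (⊥-elim)
open import Data.Fin.Subset using (Subset; Nonempty; Empty; _∩_; ⋃)
open import Data.Fin.Subset.Properties using (anySubset?; nonempty?; ∪-identityʳ)
open import Data.List using (List; []; _∷_; [_]; length; map; _++_)
open import Data.List.Membership.Propositional using (_∈_)
open import Data.List.Membership.Propositional.Properties
  using (∈-map⁺; ∈-map⁻; ∈-++⁺ˡ; ∈-++⁺ʳ)
open import Data.List.Relation.Unary.All using (All; []; _∷_; all?)
open import Data.List.Relation.Unary.AllPairs using (AllPairs; []; _∷_; allPairs?)
open import Data.List.Relation.Unary.Any using (here; any?)
open import Data.List.Relation.Unary.Unique.Propositional using (Unique)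
open import Data.List.Relation.Unary.Unique.Propositional.Properties
  using (map⁺; ++⁺)
open import Data.Nat using (ℕ; zero; suc; _+_; _∸_; _^_; _≤_; z≤n; s≤s; ⌊_/2⌋; ⌈_/2⌉; NonZero; >-nonZero⁻¹)
open import Data.Nat.Properties using (≤-refl; _≟_)
open import Data.Product using (∃; _×_; _,_; proj₁; proj₂)
open import Data.Vec using (_∷_; [])
open import Data.Vec.Properties using (≡-dec; ∷-injectiveʳ)
open import Relation.Binary.PropositionalEquality using (_≡_; refl)
open import Relation.Nullary using (Dec; yes; no; ¬_; ¬?; _×-dec_; _→-dec_)
open import Relation.Nullary.Decidable using (map′; decidable-stable)
open import Relation.Unary using (Decidable)

-- The ground set [n] is Fin n.  A family of subsets of [n] is a list of subsets
-- without repetitions, so that its length is its cardinality.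

Disjoint : ∀ {n} → Subset n → Subset n → Set
Disjoint S T = Empty (S ∩ T)

IsDisjointUnionOfAtMost : ∀ {n} → ℕ → List (Subset n) → Subset n → Set
IsDisjointUnionOfAtMost {n} k 𝒢 S =
  ∃ λ (𝒯 : List (Subset n)) →
    length 𝒯 ≤ k × All (_∈ 𝒢) 𝒯 × AllPairs Disjoint 𝒯 × ⋃ 𝒯 ≡ S

IsGenerator : (n k : ℕ) → List (Subset n) → Set
IsGenerator n k 𝒢 =
  Unique 𝒢 × (∀ (S : Subset n) → Nonempty S → IsDisjointUnionOfAtMost k 𝒢 S)

HasGeneratorOfSize : (n k m : ℕ) → Set
HasGeneratorOfSize n k m =
  ∃ λ (𝒢 : List (Subset n)) → length 𝒢 ≡ m × IsGenerator n k 𝒢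

IsMinimum : (ℕ → Set) → ℕ → Set
IsMinimum P m = P m × (∀ j → P j → m ≤ j)

-- Constructively, taking the minimum below needs the existence of a generator
-- of a given size to be decidable; this is done by exhaustive search.

module _ {n : ℕ} where

  infix 4 _≟ˢ_
  _≟ˢ_ : (S T : Subset n) → Dec (S ≡ T)
  _≟ˢ_ = ≡-dec _≟ᵇ_

  allSubsets? : {P : Subset n → Set} → Decidable P → Dec (∀ S → P S)
  allSubsets? P? = map′
    (λ ∄ S → decidable-stable (P? S) (λ ¬p → ∄ (S , ¬p)))
    (λ ∀P (S , ¬p) → ¬p (∀P S))
    (¬? (anySubset? (λ S → ¬? (P? S))))

  anyListOfLength≤? : ∀ k {P : List (Subset n) → Set} → Decidable P →
                      Dec (∃ λ 𝒯 → length 𝒯 ≤ k × P 𝒯)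
  anyListOfLength≤? zero P? = map′
    (λ p → [] , z≤n , p)
    (λ { ([] , _ , p) → p ; (_ ∷ _ , () , _) })
    (P? [])
  anyListOfLength≤? (suc k) P? with P? []
  ... | yes p = yes ([] , z≤n , p)
  ... | no ¬p = map′
    (λ (S , 𝒯 , l , p) → S ∷ 𝒯 , s≤s l , p)
    (λ { ([] , _ , p) → ⊥-elim (¬p p) ; (S ∷ 𝒯 , s≤s l , p) → S , 𝒯 , l , p })
    (anySubset? (λ S → anyListOfLength≤? k (λ 𝒯 → P? (S ∷ 𝒯))))

  isDisjointUnionOfAtMost? : ∀ k 𝒢 → Decidable (IsDisjointUnionOfAtMost {n} k 𝒢)
  isDisjointUnionOfAtMost? k 𝒢 S = anyListOfLength≤? k λ 𝒯 →
    all? (λ T → any? (T ≟ˢ_) 𝒢) 𝒯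
      ×-dec allPairs? (λ T U → ¬? (nonempty? (T ∩ U))) 𝒯
      ×-dec (⋃ 𝒯 ≟ˢ S)

  isGenerator? : ∀ k → Decidable (IsGenerator n k)
  isGenerator? k 𝒢 =
    allPairs? (λ S T → ¬? (S ≟ˢ T)) 𝒢
      ×-dec allSubsets? (λ S → nonempty? S →-dec isDisjointUnionOfAtMost? k 𝒢 S)

hasGeneratorOfSize? : ∀ n k → Decidable (HasGeneratorOfSize n k)
hasGeneratorOfSize? n k m = map′
  (λ (𝒢 , _ , e , g) → 𝒢 , e , g)
  (λ { (𝒢 , refl , g) → 𝒢 , ≤-refl , refl , g })
  (anyListOfLength≤? m (λ 𝒢 → (length 𝒢 ≟ m) ×-dec isGenerator? k 𝒢))

subsets : ∀ n → List (Subset n)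
subsets zero    = [ [] ]
subsets (suc n) = map (true ∷_) (subsets n) ++ map (false ∷_) (subsets n)

∈-subsets : ∀ {n} (S : Subset n) → S ∈ subsets n
∈-subsets []          = here refl
∈-subsets (true  ∷ S) = ∈-++⁺ˡ (∈-map⁺ (true ∷_) (∈-subsets S))
∈-subsets (false ∷ S) = ∈-++⁺ʳ _ (∈-map⁺ (false ∷_) (∈-subsets S))

subsets-unique : ∀ n → Unique (subsets n)
subsets-unique zero    = [] ∷ []
subsets-unique (suc n) = ++⁺
  (map⁺ ∷-injectiveʳ (subsets-unique n))
  (map⁺ ∷-injectiveʳ (subsets-unique n))
  λ (p , q) → heads-differ (∈-map⁻ _ p , ∈-map⁻ _ q)
  where
  heads-differ : ∀ {S} →
    ¬ ((∃ λ T → T ∈ subsets n × S ≡ true ∷ T) ×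
       (∃ λ T → T ∈ subsets n × S ≡ false ∷ T))
  heads-differ ((_ , _ , refl) , (_ , _ , ()))

subsets-isGenerator : ∀ n k .{{_ : NonZero k}} → IsGenerator n k (subsets n)
subsets-isGenerator n k = subsets-unique n , λ S _ →
  [ S ] , >-nonZero⁻¹ k , ∈-subsets S ∷ [] , [] ∷ [] , ∪-identityʳ S

minimum-exists : ∀ {P : ℕ → Set} → Decidable P → ∃ P → ∃ (IsMinimum P)
minimum-exists {P} P? (N , p) = search N P? p
  where
  search : ∀ N {Q : ℕ → Set} → Decidable Q → Q N → ∃ (IsMinimum Q)
  search zero    Q? q = zero , q , λ _ _ → z≤n
  search (suc N) Q? q with Q? zero
  ... | yes q₀ = zero , q₀ , λ _ _ → z≤n
  ... | no ¬q₀ with search N (λ j → Q? (suc j)) q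
  ...   | m , qₘ , least = suc m , qₘ , λ where
            zero    q₀ → ⊥-elim (¬q₀ q₀)
            (suc j) qⱼ → s≤s (least j qⱼ)

opt-exists : ∀ n k .{{_ : NonZero k}} → ∃ (IsMinimum (HasGeneratorOfSize n k))
opt-exists n k = minimum-exists (hasGeneratorOfSize? n k)
  (length (subsets n) , subsets n , refl , subsets-isGenerator n k)

opt : (n k : ℕ) .{{_ : NonZero k}} → ℕ
opt n k = proj₁ (opt-exists n k)

opt-isMinimum : ∀ n k .{{_ : NonZero k}} → IsMinimum (HasGeneratorOfSize n k) (opt n k)
opt-isMinimum n k = proj₂ (opt-exists n k)

-- constr(n,2); the truncated subtractions are exact because 2 ^ m ≥ 1.
constr₂ : ℕ → ℕ
constr₂ n = (2 ^ ⌊ n /2⌋ ∸ 1) + (2 ^ ⌈ n /2⌉ ∸ 1)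

{-# OPTIONS --safe #-}
-- Upper bound: the non-empty subsets of the two halves of [n] form a generator.
-- Lower bound: a generator of size m has m (m + 1) / 2 unordered pairs of members,
-- equal ones allowed, and every non-empty set is the union of such a pair, so
-- 2 (2 ^ n - 1) ≤ m (m + 1).  With 2 ^ ⌊n/2⌋ = 1 + a, for even n this reads
-- 2 a² + 4 a ≤ m² + m, and m ≤ constr₂ n = 2 a leaves 2 a² ≤ m²; for odd n it
-- forces m ≥ 2 a + 1, whereas constr₂ n = 3 a + 1.
module Submission where

open import Defs
open import Data.Bool using (true; false; _∧_; _∨_)
open import Data.Fin.Subset using (Subset; Nonempty; _∪_; ⊥)
open import Data.Fin.Subset.Properties
  using (nonempty?; Empty-unique; ∉⊥; ∪-comm; ∪-idem; ∪-identityˡ; ∪-identityʳ; ∩-zeroˡ; ∩-zeroʳ)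
open import Data.Integer as ℤ using (+_; +≤+)
import Data.Integer.Properties as ℤ
open import Data.List using (List; []; _∷_; [_]; length; map; _++_)
open import Data.List.Membership.Propositional using (_∈_)
open import Data.List.Membership.Propositional.Properties
  using (∈-map⁺; ∈-map⁻; ∈-++⁺ˡ; ∈-++⁺ʳ; ∈-++⁻; ∈-∃++)
open import Data.List.Properties using (length-++; length-map)
open import Data.List.Relation.Binary.Permutation.Propositional.Properties
  using (shift; ∈-resp-↭; ↭-length)
open import Data.List.Relation.Binary.Subset.Propositional using (_⊆_)
open import Data.List.Relation.Unary.All using ([]; _∷_)
import Data.List.Relation.Unary.All as All
open import Data.List.Relation.Unary.AllPairs using ([]; _∷_)
open import Data.List.Relation.Unary.Any using (here; there)
open import Data.List.Relation.Unary.Unique.Propositional using (Unique)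
open import Data.List.Relation.Unary.Unique.Propositional.Properties using (map⁺; ++⁺)
open import Data.Nat using (ℕ; zero; suc; _+_; _*_; _∸_; _^_; _≤_; _≤?_; z≤n; s≤s; z<s;
  ⌊_/2⌋; ⌈_/2⌉; NonZero)
open import Data.Nat.Divisibility using (_∣_; divides)
open import Data.Nat.Properties
open import Data.Nat.Tactic.RingSolver using (solve-∀)
open import Data.Product using (∃; _×_; _,_; proj₁; proj₂)
open import Data.Rational as ℚ using (_/_)
import Data.Rational.Properties as ℚ
open import Data.Rational.Unnormalised as ℚᵘ using (mkℚᵘ; *≤*)
import Data.Rational.Unnormalised.Properties as ℚᵘ
open import Data.Sum using (_⊎_; inj₁; inj₂)
open import Data.Vec as Vec using (_∷_; [])
open import Data.Vec.Properties using (∷-injectiveʳ; ++-injectiveˡ; ++-injectiveʳ; zipWith-++)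
open import Function using (_∘_)
open import Relation.Binary.PropositionalEquality
  using (_≡_; refl; sym; trans; cong; cong₂; subst; subst₂; module ≡-Reasoning)
open import Relation.Nullary using (¬_; yes; no; contradiction)

-- Counting lists without repetitions.

length-mono-⊆ : ∀ {A : Set} {xs ys : List A} → Unique xs → xs ⊆ ys → length xs ≤ length ys
length-mono-⊆ [] _ = z≤n
length-mono-⊆ {xs = x ∷ xs} (x∉xs ∷ xs!) ⊆ys
  with as , bs , refl ← ∈-∃++ (⊆ys (here refl)) = begin
  suc (length xs)           ≤⟨ s≤s (length-mono-⊆ xs! ⊆as++bs) ⟩
  suc (length (as ++ bs))   ≡⟨ ↭-length (shift x as bs) ⟨
  length (as ++ x ∷ bs)     ∎
  where
  open ≤-Reasoning
  -- One copy of `x` is deleted from `ys`. No entry of the tail equals `x`, so the tail is still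
  -- contained in what remains and induction applies.
  ⊆as++bs : xs ⊆ as ++ bs
  ⊆as++bs y∈xs with ∈-resp-↭ (shift x as bs) (⊆ys (there y∈xs))
  ... | here y≡x = contradiction (sym y≡x) (All.lookup x∉xs y∈xs)
  ... | there y∈ = y∈

length-map-++-map : ∀ {A B C : Set} (f : A → C) (g : B → C) xs ys →
                    length (map f xs ++ map g ys) ≡ length xs + length ys
length-map-++-map f g xs ys =
  trans (length-++ (map f xs)) (cong₂ _+_ (length-map f xs) (length-map g ys))

length-subsets : ∀ n → length (subsets n) ≡ 2 ^ n
length-subsets zero    = refl
length-subsets (suc n) = begin
  length (subsets (suc n))                  ≡⟨ length-map-++-map (true ∷_) (false ∷_) (subsets n) (subsets n) ⟩
  length (subsets n) + length (subsets n)   ≡⟨ cong (λ k → k + k) (length-subsets n) ⟩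
  2 ^ n + 2 ^ n                             ≡⟨ cong (λ k → 2 ^ n + k) (+-identityʳ (2 ^ n)) ⟨
  2 ^ suc n                                 ∎
  where open ≡-Reasoning

-- Counting the unions of pairs of members.

module _ {n : ℕ} where

  -- Pairing each member with itself and later ones only gives one entry per unordered pair.
  -- Coinciding unions are kept, so the length depends on the length of `𝒢` alone.
  unions : List (Subset n) → List (Subset n)
  unions []      = []
  unions (A ∷ 𝒢) = map (A ∪_) (A ∷ 𝒢) ++ unions 𝒢

  ∪-∈-unions : ∀ {𝒢 A B} → A ∈ 𝒢 → B ∈ 𝒢 → A ∪ B ∈ unions 𝒢
  ∪-∈-unions (here refl) B∈ = ∈-++⁺ˡ (∈-map⁺ _ B∈)
  -- Here `B` heads the list, so the pair is entered as `B ∪ A`.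
  ∪-∈-unions {B ∷ 𝒢} {A} (there A∈) (here refl) =
    subst (_∈ unions (B ∷ 𝒢)) (∪-comm B A) (∈-++⁺ˡ (∈-map⁺ (B ∪_) (there A∈)))
  ∪-∈-unions {C ∷ 𝒢} (there A∈) (there B∈) =
    ∈-++⁺ʳ (map (C ∪_) (C ∷ 𝒢)) (∪-∈-unions A∈ B∈)

  2*length-unions : ∀ 𝒢 → 2 * length (unions 𝒢) ≡ length 𝒢 * suc (length 𝒢)
  2*length-unions []      = refl
  2*length-unions (A ∷ 𝒢)
    rewrite length-++ (map (A ∪_) 𝒢) {unions 𝒢}
          | length-map (A ∪_) 𝒢 = begin
    2 * suc (m + u)         ≡⟨ double m u ⟩
    2 * suc m + 2 * u       ≡⟨ cong (λ v → 2 * suc m + v) (2*length-unions 𝒢) ⟩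
    2 * suc m + m * suc m   ≡⟨ factor m ⟩
    suc m * suc (suc m)     ∎
    where
    open ≡-Reasoning
    m = length 𝒢
    u = length (unions 𝒢)
    double : ∀ m u → 2 * suc (m + u) ≡ 2 * suc m + 2 * u
    double = solve-∀
    factor : ∀ m → 2 * suc m + m * suc m ≡ suc m * suc (suc m)
    factor = solve-∀

  -- A single member counts as a pair of equal sets, since union is idempotent; no members at all
  -- would give the empty set.
  generator⇒∈-unions : ∀ {𝒢} → IsGenerator n 2 𝒢 → ∀ {S} → Nonempty S → S ∈ unions 𝒢
  generator⇒∈-unions {𝒢} (_ , gen) {S} S≢∅ with gen S S≢∅
  ... | [] , _ , _ , _ , refl = contradiction (proj₂ S≢∅) ∉⊥
  ... | A ∷ [] , _ , A∈ ∷ [] , _ , refl =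
    subst (_∈ unions 𝒢) (trans (∪-idem A) (sym (∪-identityʳ A))) (∪-∈-unions A∈ A∈)
  ... | A ∷ B ∷ [] , _ , A∈ ∷ B∈ ∷ [] , _ , refl =
    subst (λ C → A ∪ C ∈ unions 𝒢) (sym (∪-identityʳ B)) (∪-∈-unions A∈ B∈)
  ... | _ ∷ _ ∷ _ ∷ _ , s≤s (s≤s ()) , _

  -- With `⊥` put in front, the unions cover all subsets. Doubled, this extra entry is the summand
  -- 2, and no subtraction occurs.
  generator-bound : ∀ {m} → HasGeneratorOfSize n 2 m → 2 * 2 ^ n ≤ 2 + m * suc m
  generator-bound (𝒢 , refl , gen) = begin
    2 * 2 ^ n                         ≡⟨ cong (2 *_) (length-subsets n) ⟨
    2 * length (subsets n)            ≤⟨ *-monoʳ-≤ 2 (length-mono-⊆ (subsets-unique n) subsets⊆) ⟩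
    2 * suc (length (unions 𝒢))       ≡⟨ *-suc 2 (length (unions 𝒢)) ⟩
    2 + 2 * length (unions 𝒢)         ≡⟨ cong (λ v → 2 + v) (2*length-unions 𝒢) ⟩
    2 + length 𝒢 * suc (length 𝒢)     ∎
    where
    open ≤-Reasoning
    covered : ∀ S → S ∈ ⊥ ∷ unions 𝒢
    covered S with nonempty? S
    ... | yes S≢∅ = there (generator⇒∈-unions gen S≢∅)
    ... | no S≡∅  = here (Empty-unique S≡∅)
    subsets⊆ : subsets n ⊆ ⊥ ∷ unions 𝒢
    subsets⊆ {S} _ = covered S

-- The generator from two blocks.

nonemptySubsets : ∀ n → List (Subset n)
nonemptySubsets zero    = []
nonemptySubsets (suc n) = map (true ∷_) (subsets n) ++ map (false ∷_) (nonemptySubsets n)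

∈-nonemptySubsets⁺ : ∀ {n} {S : Subset n} → Nonempty S → S ∈ nonemptySubsets n
∈-nonemptySubsets⁺ {S = true ∷ S} _ = ∈-++⁺ˡ (∈-map⁺ (true ∷_) (∈-subsets S))
∈-nonemptySubsets⁺ {S = false ∷ S} (_ , Vec.there x∈S) =
  ∈-++⁺ʳ _ (∈-map⁺ (false ∷_) (∈-nonemptySubsets⁺ (_ , x∈S)))

∈-nonemptySubsets⁻ : ∀ {n} {S : Subset n} → S ∈ nonemptySubsets n → Nonempty S
∈-nonemptySubsets⁻ {suc n} S∈ with ∈-++⁻ (map (true ∷_) (subsets n)) S∈
... | inj₁ S∈ˡ with _ , _ , refl ← ∈-map⁻ (true ∷_) S∈ˡ = _ , Vec.here
... | inj₂ S∈ʳ with _ , T∈ , refl ← ∈-map⁻ (false ∷_) S∈ʳ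
    with _ , x∈T ← ∈-nonemptySubsets⁻ T∈ = _ , Vec.there x∈T

nonemptySubsets-unique : ∀ n → Unique (nonemptySubsets n)
nonemptySubsets-unique zero    = []
nonemptySubsets-unique (suc n) = ++⁺
  (map⁺ ∷-injectiveʳ (subsets-unique n))
  (map⁺ ∷-injectiveʳ (nonemptySubsets-unique n))
  λ (p , q) → heads-differ (∈-map⁻ (true ∷_) p) (∈-map⁻ (false ∷_) q)
  where
  heads-differ : ∀ {S} → (∃ λ T → T ∈ subsets n × S ≡ true ∷ T) →
                 ¬ (∃ λ T → T ∈ nonemptySubsets n × S ≡ false ∷ T)
  heads-differ (_ , _ , refl) (_ , _ , ())

-- Adding one for the missing empty set keeps truncated subtraction out of the induction.
suc-length-nonemptySubsets : ∀ n → suc (length (nonemptySubsets n)) ≡ 2 ^ n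
suc-length-nonemptySubsets zero    = refl
suc-length-nonemptySubsets (suc n) = begin
  suc (length (nonemptySubsets (suc n)))
    ≡⟨ cong suc (length-map-++-map (true ∷_) (false ∷_) (subsets n) (nonemptySubsets n)) ⟩
  suc (length (subsets n) + length (nonemptySubsets n))
    ≡⟨ +-suc (length (subsets n)) _ ⟨
  length (subsets n) + suc (length (nonemptySubsets n))
    ≡⟨ cong₂ _+_ (length-subsets n) (suc-length-nonemptySubsets n) ⟩
  2 ^ n + 2 ^ n
    ≡⟨ cong (λ k → 2 ^ n + k) (+-identityʳ (2 ^ n)) ⟨
  2 ^ suc n
    ∎
  where open ≡-Reasoning

length-nonemptySubsets : ∀ n → length (nonemptySubsets n) ≡ 2 ^ n ∸ 1
length-nonemptySubsets n = cong (_∸ 1) (suc-length-nonemptySubsets n)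

⊥-++ : ∀ p {q} → ⊥ {p} Vec.++ ⊥ {q} ≡ ⊥
⊥-++ zero    = refl
⊥-++ (suc p) = cong (false ∷_) (⊥-++ p)

module _ (p q : ℕ) where

  extendʳ : Subset p → Subset (p + q)
  extendʳ S = S Vec.++ ⊥

  extendˡ : Subset q → Subset (p + q)
  extendˡ T = ⊥ Vec.++ T

  twoBlocks : List (Subset (p + q))
  twoBlocks = map extendʳ (nonemptySubsets p) ++ map extendˡ (nonemptySubsets q)

  length-twoBlocks : length twoBlocks ≡ (2 ^ p ∸ 1) + (2 ^ q ∸ 1)
  length-twoBlocks = trans
    (length-map-++-map extendʳ extendˡ (nonemptySubsets p) (nonemptySubsets q))
    (cong₂ _+_ (length-nonemptySubsets p) (length-nonemptySubsets q))

  twoBlocks-unique : Unique twoBlocks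
  twoBlocks-unique = ++⁺
    (map⁺ (++-injectiveˡ _ _) (nonemptySubsets-unique p))
    (map⁺ (++-injectiveʳ ⊥ ⊥) (nonemptySubsets-unique q))
    λ (r , s) → separated (∈-map⁻ extendʳ r) (∈-map⁻ extendˡ s)
    where
    separated : ∀ {U} → (∃ λ S → S ∈ nonemptySubsets p × U ≡ extendʳ S) →
                ¬ (∃ λ T → T ∈ nonemptySubsets q × U ≡ extendˡ T)
    separated (S , S∈ , U≡) (_ , _ , U≡′)
      -- A set in both lists would have `⊥` as its first block, but `S` is non-empty.
      with refl ← ++-injectiveˡ S ⊥ (trans (sym U≡) U≡′) =
      contradiction (proj₂ (∈-nonemptySubsets⁻ S∈)) ∉⊥

  -- Intersection acts blockwise, and in each block one of the two sets is empty.
  extend-disjoint : ∀ S T → Disjoint (extendʳ S) (extendˡ T)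
  extend-disjoint S T rewrite zipWith-++ _∧_ S ⊥ ⊥ T
    | ∩-zeroʳ S | ∩-zeroˡ T | ⊥-++ p {q} = ∉⊥ ∘ proj₂

  extend-∪ : ∀ S T → extendʳ S ∪ extendˡ T ≡ S Vec.++ T
  extend-∪ S T = trans (zipWith-++ _∨_ S ⊥ ⊥ T)
    (cong₂ Vec._++_ (∪-identityʳ S) (∪-identityˡ T))

  twoBlocks-isGenerator : IsGenerator (p + q) 2 twoBlocks
  twoBlocks-isGenerator = twoBlocks-unique , decompose
    where
    extendʳ∈ : ∀ {S} → Nonempty S → extendʳ S ∈ twoBlocks
    extendʳ∈ S≢∅ = ∈-++⁺ˡ (∈-map⁺ extendʳ (∈-nonemptySubsets⁺ S≢∅))

    extendˡ∈ : ∀ {T} → Nonempty T → extendˡ T ∈ twoBlocks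
    extendˡ∈ T≢∅ =
      ∈-++⁺ʳ (map extendʳ (nonemptySubsets p)) (∈-map⁺ extendˡ (∈-nonemptySubsets⁺ T≢∅))

    decompose : ∀ U → Nonempty U → IsDisjointUnionOfAtMost 2 twoBlocks U
    -- `U` is cut into its two blocks; the non-empty ones supply the members.
    decompose U U≢∅ with Vec.splitAt p U
    ... | S , T , refl with nonempty? S | nonempty? T
    ... | yes S≢∅ | yes T≢∅ =
      extendʳ S ∷ extendˡ T ∷ [] , s≤s (s≤s z≤n)
      , extendʳ∈ S≢∅ ∷ extendˡ∈ T≢∅ ∷ []
      , (extend-disjoint S T ∷ []) ∷ [] ∷ []
      , trans (cong (extendʳ S ∪_) (∪-identityʳ (extendˡ T))) (extend-∪ S T)
    -- Once `T` is rewritten to `⊥`, `U` is `extendʳ S` by definition.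
    ... | yes S≢∅ | no T≡∅ rewrite Empty-unique T≡∅ =
      [ extendʳ S ] , s≤s z≤n , extendʳ∈ S≢∅ ∷ [] , [] ∷ [] , ∪-identityʳ _
    ... | no S≡∅ | yes T≢∅ rewrite Empty-unique S≡∅ =
      [ extendˡ T ] , s≤s z≤n , extendˡ∈ T≢∅ ∷ [] , [] ∷ [] , ∪-identityʳ _
    ... | no S≡∅ | no T≡∅ rewrite Empty-unique S≡∅ | Empty-unique T≡∅ | ⊥-++ p {q} =
      contradiction (proj₂ U≢∅) ∉⊥

hasGenerator-constr₂ : ∀ n → HasGeneratorOfSize n 2 (constr₂ n)
hasGenerator-constr₂ n = subst (λ k → HasGeneratorOfSize k 2 (constr₂ n)) (⌊n/2⌋+⌈n/2⌉≡n n)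
  (twoBlocks p q , length-twoBlocks p q , twoBlocks-isGenerator p q)
  where
  p = ⌊ n /2⌋
  q = ⌈ n /2⌉

-- Both bounds applied to `opt`.

opt≤constr₂ : ∀ n → opt n 2 ≤ constr₂ n
opt≤constr₂ n = proj₂ (opt-isMinimum n 2) _ (hasGenerator-constr₂ n)

-- The power of 2 is split over the two halves so that `suc a` can later replace `2 ^ ⌊ n /2⌋`.
opt-bound : ∀ n → 2 * (2 ^ ⌊ n /2⌋ * 2 ^ ⌈ n /2⌉) ≤ 2 + opt n 2 * suc (opt n 2)
opt-bound n
  rewrite sym (^-distribˡ-+-* 2 ⌊ n /2⌋ ⌈ n /2⌉) | ⌊n/2⌋+⌈n/2⌉≡n n =
  generator-bound (proj₁ (opt-isMinimum n 2))

-- Parity and the arithmetic of the bounds.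

⌈n/2⌉≡⌊n/2⌋⊎1+⌊n/2⌋ : ∀ n → ⌈ n /2⌉ ≡ ⌊ n /2⌋ ⊎ ⌈ n /2⌉ ≡ suc ⌊ n /2⌋
⌈n/2⌉≡⌊n/2⌋⊎1+⌊n/2⌋ zero       = inj₁ refl
⌈n/2⌉≡⌊n/2⌋⊎1+⌊n/2⌋ (suc zero) = inj₂ refl
⌈n/2⌉≡⌊n/2⌋⊎1+⌊n/2⌋ (suc (suc n)) with ⌈n/2⌉≡⌊n/2⌋⊎1+⌊n/2⌋ n
... | inj₁ eq = inj₁ (cong suc eq)
... | inj₂ eq = inj₂ (cong suc eq)

2∣n⇒⌈n/2⌉≡⌊n/2⌋ : ∀ {n} → 2 ∣ n → ⌈ n /2⌉ ≡ ⌊ n /2⌋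
2∣n⇒⌈n/2⌉≡⌊n/2⌋ (divides q refl) = double q
  where
  double : ∀ q → ⌈ q * 2 /2⌉ ≡ ⌊ q * 2 /2⌋
  double zero    = refl
  double (suc q) = cong suc (double q)

-- In successor form, the truncated subtraction of 1 computes.
2^k≡1+ : ∀ k → ∃ λ a → 2 ^ k ≡ suc a
2^k≡1+ k = _ , sym (suc-pred (2 ^ k) {{m^n≢0 2 k}})

-- Here `a + a` stands for `constr₂ n` and `m` for `opt n 2`; squaring expresses the factor √2
-- within ℕ.
even-arith : ∀ a m → 2 * (suc a * suc a) ≤ 2 + m * suc m → m ≤ a + a →
             (a + a) ^ 2 ≤ 2 * m ^ 2
even-arith a m bound m≤2a = begin
  (a + a) ^ 2               ≡⟨ e₁ a ⟩
  2 * (2 * (a * a))         ≤⟨ *-monoʳ-≤ 2 (+-cancelʳ-≤ (2 + (a + a)) _ _ 2a²≤m²) ⟩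
  2 * m ^ 2                 ∎
  where
  open ≤-Reasoning
  -- Squares are spelt as `x * (x * 1)`, to which `x ^ 2` reduces.
  e₁ : ∀ a → (a + a) * ((a + a) * 1) ≡ 2 * (2 * (a * a))
  e₁ = solve-∀
  e₂ : ∀ a → 2 * (a * a) + (2 + (a + a)) + (a + a) ≡ 2 * (suc a * suc a)
  e₂ = solve-∀
  e₃ : ∀ m → 2 + m * suc m ≡ m * (m * 1) + (2 + m)
  e₃ = solve-∀
  -- 2 (a + 1)² is 2 a² + (2 + 2 a) + 2 a. Dropping the last 2 a and bounding 2 + m by 2 + 2 a on
  -- the right leaves a common summand to cancel.
  2a²≤m² : 2 * (a * a) + (2 + (a + a)) ≤ m ^ 2 + (2 + (a + a))
  2a²≤m² = begin
    2 * (a * a) + (2 + (a + a))             ≤⟨ m≤m+n _ (a + a) ⟩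
    2 * (a * a) + (2 + (a + a)) + (a + a)   ≡⟨ e₂ a ⟩
    2 * (suc a * suc a)                     ≤⟨ bound ⟩
    2 + m * suc m                           ≡⟨ e₃ m ⟩
    m ^ 2 + (2 + m)                         ≤⟨ +-monoʳ-≤ (m ^ 2) (+-monoʳ-≤ 2 m≤2a) ⟩
    m ^ 2 + (2 + (a + a))                   ∎

odd-arith : ∀ a m → 2 * (suc a * (2 * suc a)) ≤ 2 + m * suc m →
            2 * (a + (2 * suc a ∸ 1)) ≤ 3 * m
odd-arith a m bound with m ≤? 2 * a
-- For m ≤ 2 a the right side of `bound` is at most 4 a² + 2 a + 2, which falls short of the left
-- side 4 a² + 8 a + 4 by 6 a + 2.
... | yes m≤2a = contradiction (begin-strict
  2 + m * suc m                       ≤⟨ +-monoʳ-≤ 2 (*-mono-≤ m≤2a (s≤s m≤2a)) ⟩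
  2 + 2 * a * suc (2 * a)             <⟨ m<n+m _ {suc (6 * a + 1)} z<s ⟩
  suc (6 * a + 1) + (2 + 2 * a * suc (2 * a)) ≡⟨ e a ⟩
  2 * (suc a * (2 * suc a))           ∎) (≤⇒≯ bound)
  where
  open ≤-Reasoning
  e : ∀ a → suc (6 * a + 1) + (2 + 2 * a * suc (2 * a)) ≡ 2 * (suc a * (2 * suc a))
  e = solve-∀
-- Now m ≥ 2 a + 1, and 2 (3 a + 1) is one less than 3 (2 a + 1).
... | no m≰2a = begin
  2 * (a + (2 * suc a ∸ 1))       ≤⟨ n≤1+n _ ⟩
  suc (2 * (a + (2 * suc a ∸ 1))) ≡⟨ e a ⟩
  3 * suc (2 * a)             ≤⟨ *-monoʳ-≤ 3 (≰⇒> m≰2a) ⟩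
  3 * m                       ∎
  where
  open ≤-Reasoning
  -- `a + 1 * suc a` is what `2 * suc a ∸ 1` reduces to.
  e : ∀ a → suc (2 * (a + (a + 1 * suc a))) ≡ 3 * suc (2 * a)
  e = solve-∀

^2-cancel-≤ : ∀ {m n} → m ^ 2 ≤ n ^ 2 → m ≤ n
^2-cancel-≤ m²≤n² = ≮⇒≥ λ n<m → ≤⇒≯ m²≤n² (^-monoˡ-< 2 n<m)

-- This is √2 ≤ 3/2 in squared form: 4 c² ≤ 8 m² ≤ 9 m².
c²≤2m²⇒2c≤3m : ∀ c m → c ^ 2 ≤ 2 * m ^ 2 → 2 * c ≤ 3 * m
c²≤2m²⇒2c≤3m c m c²≤2m² = ^2-cancel-≤ (begin
  (2 * c) ^ 2          ≡⟨ e₁ c ⟩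
  4 * c ^ 2            ≤⟨ *-monoʳ-≤ 4 c²≤2m² ⟩
  4 * (2 * m ^ 2)      ≤⟨ m≤m+n _ (m ^ 2) ⟩
  4 * (2 * m ^ 2) + m ^ 2 ≡⟨ e₂ m ⟩
  (3 * m) ^ 2          ∎)
  where
  open ≤-Reasoning
  e₁ : ∀ c → (2 * c) * ((2 * c) * 1) ≡ 4 * (c * (c * 1))
  e₁ = solve-∀
  e₂ : ∀ m → 4 * (2 * (m * (m * 1))) + m * (m * 1) ≡ (3 * m) * ((3 * m) * 1)
  e₂ = solve-∀

-- Assuming equal halves instead of divisibility by 2 makes this usable in the parity split for the
-- factor 3/2 as well.
constr₂²≤2*opt² : ∀ n → ⌈ n /2⌉ ≡ ⌊ n /2⌋ → constr₂ n ^ 2 ≤ 2 * opt n 2 ^ 2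
constr₂²≤2*opt² n eq with opt-bound n | opt≤constr₂ n
... | bound | opt≤ rewrite eq with a , 2^≡ ← 2^k≡1+ ⌊ n /2⌋ rewrite 2^≡ =
  even-arith a (opt n 2) bound opt≤

-- Equal halves inherit the bound from the sharper factor √2; unequal halves need the direct
-- estimate `odd-arith`.
2*constr₂≤3*opt : ∀ n → 2 * constr₂ n ≤ 3 * opt n 2
2*constr₂≤3*opt n with ⌈n/2⌉≡⌊n/2⌋⊎1+⌊n/2⌋ n
... | inj₁ eq = c²≤2m²⇒2c≤3m (constr₂ n) (opt n 2) (constr₂²≤2*opt² n eq)
... | inj₂ eq with opt-bound n
...   | bound rewrite eq with a , 2^≡ ← 2^k≡1+ ⌊ n /2⌋ rewrite 2^≡ =
  odd-arith a (opt n 2) bound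

-- For unnormalised fractions the order is cross-multiplication of integers, here `c * 2` against
-- `3 * m * 1`.
2*c≤3*m⇒c≤3/2*m : ∀ c m → 2 * c ≤ 3 * m → (+ c / 1) ℚ.≤ (+ 3 / 2) ℚ.* (+ m / 1)
2*c≤3*m⇒c≤3/2*m c m 2c≤3m = ℚ.toℚᵘ-cancel-≤ (begin
  ℚ.toℚᵘ (+ c / 1)                             ≃⟨ ℚ.toℚᵘ-fromℚᵘ (mkℚᵘ (+ c) 0) ⟩
  mkℚᵘ (+ c) 0                                 ≤⟨ *≤* (subst₂ ℤ._≤_ l r (+≤+ 2c≤3m)) ⟩
  mkℚᵘ (+ 3) 1 ℚᵘ.* mkℚᵘ (+ m) 0               ≃⟨ ℚᵘ.*-congˡ {mkℚᵘ (+ 3) 1} (ℚ.toℚᵘ-fromℚᵘ (mkℚᵘ (+ m) 0)) ⟨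
  ℚ.toℚᵘ (+ 3 / 2) ℚᵘ.* ℚ.toℚᵘ (+ m / 1)       ≃⟨ ℚ.toℚᵘ-homo-* (+ 3 / 2) (+ m / 1) ⟨
  ℚ.toℚᵘ ((+ 3 / 2) ℚ.* (+ m / 1))             ∎)
  where
  open ℚᵘ.≤-Reasoning
  l : + (2 * c) ≡ + c ℤ.* + 2
  l = trans (cong +_ (*-comm 2 c)) (ℤ.pos-* c 2)
  r : + (3 * m) ≡ + 3 ℤ.* + m ℤ.* + 1
  r = trans (ℤ.pos-* 3 m) (sym (ℤ.*-identityʳ _))

theorem6 : (n : ℕ) .{{_ : NonZero n}} →
    opt n 2 ≤ constr₂ n
    × (+ constr₂ n / 1) ℚ.≤ (+ 3 / 2) ℚ.* (+ opt n 2 / 1)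
    × (2 ∣ n → constr₂ n ^ 2 ≤ 2 * opt n 2 ^ 2)
theorem6 n =
  opt≤constr₂ n
  , 2*c≤3*m⇒c≤3/2*m (constr₂ n) (opt n 2) (2*constr₂≤3*opt n)
  , λ 2∣n → constr₂²≤2*opt² n (2∣n⇒⌈n/2⌉≡⌊n/2⌋ 2∣n)
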